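{- For any $2$-caterpillar $C$, $\mu_g(C) \le 3$.
   Context: A $2$-caterpillar is a finite tree obtained from a path (the spine) by attaching to each spine vertex any finite number (possibly zero) of legs, where each leg is a path of length $1$ or $2$ attached to the spine vertex by one of its endpoints (i.e. a caterpillar with leg lengths up to two). Majority coloring game: given a graph $G$ and a palette of $k$ colors, two players Alice and Bob alternately (Alice first) choose an uncolored vertex of $G$ and assign it a color from the palette, so that after every move the majority condition holds: for every colored vertex $v$, at most $\deg(v)/2$ of the neighbors of $v$ have the same color as $v$. (Uncolored vertices impose no condition; $\deg(v)$ is the degree in the whole graph $G$.) Alice wins if all vertices get colored; Bob wins if at some point there is an uncolored vertex to which no color of the palette can be legally assigned. The majority game chromatic number $\mu_g(G)$ is the least $k$ such that Alice has a winning strategy with a palette of $k$ colors. -}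

module Defs where

open import Data.Fin using (Fin; toℕ)
open import Data.Fin.Properties using () renaming (_≟_ to _≟ᶠ_)
open import Data.List using (List; length; lookup; filter; allFin)
open import Data.Maybe using (Maybe; just; nothing)
open import Data.Maybe.Properties using (≡-dec)
open import Data.Nat using (ℕ; suc; _*_; _≤_; _<_)
open import Data.Product using (∃-syntax; _×_)
open import Data.Vec as Vec using (Vec; replicate; _[_]≔_)
open import Function.Bundles using (_⤖_; _⇔_; module Bijection)
open import Level using (0ℓ)
open import Relation.Binary.Construct.Closure.Symmetric using (SymClosure)
open import Relation.Binary.Core using (Rel)
open import Relation.Binary.Definitions using (Symmetric; Irreflexive; Decidable)
open import Relation.Binary.PropositionalEquality using (_≡_)
open import Relation.Nullary using (¬_)
open import Relation.Nullary.Decidable using (_×-dec_)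

record Graph (n : ℕ) : Set₁ where
  infix 4 _~_ _~?_
  field
    _~_      : Rel (Fin n) 0ℓ
    ~-sym    : Symmetric _~_
    ~-irrefl : Irreflexive _≡_ _~_
    _~?_     : Decidable _~_

  degree : Fin n → ℕ
  degree v = length (filter (v ~?_) (allFin n))

data LegLength : Set where
  one two : LegLength

⟦_⟧ : LegLength → ℕ
⟦ one ⟧ = 1
⟦ two ⟧ = 2

record CaterpillarShape : Set where
  field
    spineLength : ℕ                                      -- number of spine edges
    legs        : Fin (suc spineLength) → List LegLength

module _ (S : CaterpillarShape) where
  open CaterpillarShape S

  -- A leg of length ℓ contributes ℓ vertices besides the spine vertex it is
  -- attached to; position 0 is the one next to the spine.
  data Vertex : Set where
    spine : Fin (suc spineLength) → Vertex
    leg   : ∀ i (j : Fin (length (legs i))) → Fin ⟦ lookup (legs i) j ⟧ → Vertex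

  data Edge : Rel Vertex 0ℓ where
    along-spine : ∀ {i i′} → toℕ i′ ≡ suc (toℕ i) → Edge (spine i) (spine i′)
    attach      : ∀ {i j p} → toℕ p ≡ 0 → Edge (spine i) (leg i j p)
    along-leg   : ∀ {i j p p′} → toℕ p′ ≡ suc (toℕ p) →
                  Edge (leg i j p) (leg i j p′)

record Is2Caterpillar {n : ℕ} (G : Graph n) : Set where
  open Graph G
  field
    shape  : CaterpillarShape
    vertex : Fin n ⤖ Vertex shape
    edges  : ∀ u v → (u ~ v) ⇔
             SymClosure (Edge shape) (Bijection.to vertex u) (Bijection.to vertex v)

Colouring : ℕ → ℕ → Set
Colouring n k = Vec (Maybe (Fin k)) n

data Player : Set where
  alice bob : Player

module _ {n : ℕ} (G : Graph n) where
  open Graph G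

  module _ {k : ℕ} where

    neighboursColoured : Colouring n k → Fin n → Fin k → ℕ
    neighboursColoured χ v c =
      length (filter (λ u → (v ~? u) ×-dec ≡-dec _≟ᶠ_ (Vec.lookup χ u) (just c))
                     (allFin n))

    Majority : Colouring n k → Set
    Majority χ = ∀ v c → Vec.lookup χ v ≡ just c →
                 2 * neighboursColoured χ v c ≤ degree v

    Uncoloured : Colouring n k → Fin n → Set
    Uncoloured χ v = Vec.lookup χ v ≡ nothing

    Legal : Colouring n k → Fin n → Fin k → Set
    Legal χ v c = Uncoloured χ v × Majority (χ [ v ]≔ just c)

    AllColoured : Colouring n k → Set
    AllColoured χ = ∀ v → ∃[ c ] Vec.lookup χ v ≡ just c

    Blocked : Colouring n k → Set
    Blocked χ = ∃[ v ] (Uncoloured χ v × (∀ c → ¬ Legal χ v c))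

    -- Winning strategy trees for Alice from position χ with the given player
    -- to move.  A blocked position is already won by Bob, so it has none.
    data WinningStrategy : Player → Colouring n k → Set where
      finished   : ∀ {p χ} → AllColoured χ → WinningStrategy p χ
      alice-move : ∀ {χ} → ¬ Blocked χ → ∀ v c → Legal χ v c →
                   WinningStrategy bob (χ [ v ]≔ just c) →
                   WinningStrategy alice χ
      bob-move   : ∀ {χ} → ¬ Blocked χ →
                   (∀ v c → Legal χ v c →
                    WinningStrategy alice (χ [ v ]≔ just c)) →
                   WinningStrategy bob χ

  AliceWins : ℕ → Set
  AliceWins k = WinningStrategy {k} alice (replicate n nothing)

  IsMajorityGameChromaticNumber : ℕ → Set
  IsMajorityGameChromaticNumber k = AliceWins k × (∀ j → j < k → ¬ AliceWins j)

{-# OPTIONS --safe #-}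
module Submission where

-- With three colours a vertex of degree at most two always has a colour absent
-- from its neighbourhood, so only spine vertices can become blocked.  Call a
-- coloured spine vertex saturated if one more neighbour of its own colour would
-- break its majority condition.  Alice plays on the spine (first at its end) and
-- keeps, after each of her moves:
--  * no uncoloured spine vertex has a coloured leg neighbour;
--  * no coloured spine vertex between two uncoloured ones can be saturated by
--    colouring one of its leg neighbours;
--  * no violation: two saturated vertices, each with an uncoloured neighbour on the
--    side facing the other, always have two consecutive coloured vertices between
--    those neighbours.
-- If Bob colours a leg neighbour of an uncoloured v, Alice colours v, with a colour
-- absent around v if there is one.  Otherwise the two spine neighbours of v have
-- distinct colours, and she reuses one of them: if reusing either created a
-- violation, these two violations would have formed a single one through v before.
-- After any other move of Bob all violations lie on one side of his vertex, for the
-- same reason, and colouring the uncoloured vertex next to the saturated one with a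
-- colour absent around it removes them.

open import Data.Empty using (⊥-elim)
open import Data.Fin using (Fin; zero; suc; toℕ)
open import Data.Fin.Properties using (any?; all?; toℕ-injective; toℕ<n) renaming (_≟_ to _≟ᶠ_)
open import Data.List using (List; []; _∷_; length; filter; allFin; _++_)
open import Data.List.Membership.Propositional using (_∈_)
open import Data.List.Membership.Propositional.Properties using (∈-∃++; ∈-++⁻; ∈-++⁺ˡ; ∈-++⁺ʳ; ∈-filter⁺; ∈-filter⁻; ∈-allFin)
open import Data.List.Properties using (length-++-sucʳ)
open import Data.List.Relation.Unary.All as All using (All; []; _∷_)
open import Data.List.Relation.Unary.AllPairs using ([]; _∷_)
open import Data.List.Relation.Unary.Any using (here; there)
open import Data.List.Relation.Unary.Unique.Propositional using (Unique)
open import Data.List.Relation.Unary.Unique.Propositional.Properties using (allFin⁺; filter⁺)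
open import Data.Maybe using (Maybe; just; nothing)
open import Data.Maybe.Properties using (≡-dec; just-injective)
open import Data.Nat using (ℕ; zero; suc; _+_; _*_; _≤_; _<_; z≤n; s≤s; _≤?_; _<?_)
open import Data.Nat.Properties
open import Data.Product using (∃-syntax; _×_; _,_; proj₁; proj₂)
open import Data.Sum using (_⊎_; inj₁; inj₂; [_,_]′) renaming (map to map⊎)
open import Data.Vec as Vec using (replicate; _[_]≔_)
open import Data.Vec.Properties using (lookup∘update; lookup∘update′; lookup-replicate)
open import Function using (_∘_)
open import Function.Bundles using (module Bijection; module Equivalence)
open import Level using (0ℓ)
open import Relation.Binary.Construct.Closure.Symmetric using (SymClosure; fwd; bwd)
open import Relation.Binary.PropositionalEquality using (_≡_; _≢_; refl; sym; trans; cong; subst)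
open import Relation.Nullary using (¬_; Dec; yes; no; contradiction)
open import Relation.Nullary.Decidable using (_×-dec_; _⊎-dec_; _→-dec_; ¬?) renaming (map′ to mapDec)
open import Relation.Unary using (Pred; Decidable)
open import Defs

-- Counting

-- Induction on `xs`: the head is cut out of `ys`, and by uniqueness the tail still lies in what
-- remains.
unique-⊆-length : ∀ {A : Set} {xs ys : List A} → Unique xs →
                  (∀ {x} → x ∈ xs → x ∈ ys) → length xs ≤ length ys
unique-⊆-length [] _ = z≤n
unique-⊆-length {xs = x ∷ xs} (x∉xs ∷ uxs) xs⊆ys with ∈-∃++ (xs⊆ys (here refl))
... | as , bs , refl = ≤-trans (s≤s (unique-⊆-length uxs sub)) (≤-reflexive (sym (length-++-sucʳ as x bs)))
  where
  sub : ∀ {y} → y ∈ xs → y ∈ as ++ bs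
  sub y∈xs with ∈-++⁻ as (xs⊆ys (there y∈xs))
  ... | inj₁ y∈as         = ∈-++⁺ˡ y∈as
  ... | inj₂ (here refl)  = contradiction refl (All.lookup x∉xs y∈xs)
  ... | inj₂ (there y∈bs) = ∈-++⁺ʳ as y∈bs

module _ {n : ℕ} {P Q : Pred (Fin n) 0ℓ} (P? : Decidable P) (Q? : Decidable Q) where

  count-mono : (∀ u → P u → Q u) → length (filter P? (allFin n)) ≤ length (filter Q? (allFin n))
  count-mono P⊆Q = unique-⊆-length (filter⁺ P? (allFin⁺ n))
    λ u∈ → ∈-filter⁺ Q? (∈-allFin _) (P⊆Q _ (proj₂ (∈-filter⁻ P? {xs = allFin n} u∈)))

  count-insert : ∀ x → (∀ u → P u → u ≡ x ⊎ Q u) →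
                 length (filter P? (allFin n)) ≤ suc (length (filter Q? (allFin n)))
  count-insert x P⊆xQ = unique-⊆-length {ys = x ∷ filter Q? (allFin n)} (filter⁺ P? (allFin⁺ n))
    λ u∈ → sub (P⊆xQ _ (proj₂ (∈-filter⁻ P? {xs = allFin n} u∈)))
    where
    sub : ∀ {u} → u ≡ x ⊎ Q u → u ∈ x ∷ filter Q? (allFin n)
    sub (inj₁ refl) = here refl
    sub (inj₂ q)    = there (∈-filter⁺ Q? (∈-allFin _) q)

  count-delete : ∀ x → ¬ P x → Q x → (∀ u → P u → Q u) →
                 suc (length (filter P? (allFin n))) ≤ length (filter Q? (allFin n))
  count-delete x ¬Px Qx P⊆Q = unique-⊆-length {xs = x ∷ filter P? (allFin n)}
    (All.tabulate (λ u∈ x≡u → ¬Px (subst P (sym x≡u) (proj₂ (∈-filter⁻ P? {xs = allFin n} u∈))))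
      ∷ filter⁺ P? (allFin⁺ n)) sub
    where
    sub : ∀ {u} → u ∈ x ∷ filter P? (allFin n) → u ∈ filter Q? (allFin n)
    sub (here refl) = ∈-filter⁺ Q? (∈-allFin _) Qx
    sub (there u∈)  = ∈-filter⁺ Q? (∈-allFin _) (P⊆Q _ (proj₂ (∈-filter⁻ P? {xs = allFin n} u∈)))

module _ {n : ℕ} {P : Pred (Fin n) 0ℓ} (P? : Decidable P) where

  count-≤ : ∀ ys → (∀ u → P u → u ∈ ys) → length (filter P? (allFin n)) ≤ length ys
  count-≤ ys P⊆ys = unique-⊆-length (filter⁺ P? (allFin⁺ n)) λ u∈ → P⊆ys _ (proj₂ (∈-filter⁻ P? {xs = allFin n} u∈))

  count-≥ : ∀ {xs} → Unique xs → All P xs → length xs ≤ length (filter P? (allFin n))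
  count-≥ uxs Pxs = unique-⊆-length uxs λ x∈ → ∈-filter⁺ P? (∈-allFin _) (All.lookup Pxs x∈)

-- Deciding the game by exhaustive search

module _ {n k : ℕ} where

  uncoloured? : (χ : Colouring n k) → Decidable (λ v → Vec.lookup χ v ≡ nothing)
  uncoloured? χ v = ≡-dec _≟ᶠ_ (Vec.lookup χ v) nothing

  #uncoloured : Colouring n k → ℕ
  #uncoloured χ = length (filter (uncoloured? χ) (allFin n))

  uncoloured-update : ∀ (χ : Colouring n k) {v w c} → Vec.lookup (χ [ v ]≔ just c) w ≡ nothing →
                      w ≢ v × Vec.lookup χ w ≡ nothing
  uncoloured-update χ {v} {w} {c} eq = w≢v , trans (sym (lookup∘update′ w≢v χ (just c))) eq
    where
    w≢v : w ≢ v
    w≢v refl with trans (sym eq) (lookup∘update v χ (just c))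
    ... | ()

  #uncoloured-update : ∀ (χ : Colouring n k) {v} c → Vec.lookup χ v ≡ nothing →
                       #uncoloured (χ [ v ]≔ just c) < #uncoloured χ
  #uncoloured-update χ {v} c eq =
    count-delete (uncoloured? (χ [ v ]≔ just c)) (uncoloured? χ) v
      (λ p → proj₁ (uncoloured-update χ p) refl) eq (λ u p → proj₂ (uncoloured-update χ {c = c} p))

  coloured-or-not : ∀ (χ : Colouring n k) v → Vec.lookup χ v ≡ nothing ⊎ ∃[ c ] Vec.lookup χ v ≡ just c
  coloured-or-not χ v with Vec.lookup χ v
  ... | nothing = inj₁ refl
  ... | just c  = inj₂ (c , refl)

  allColoured-or-not : ∀ (G : Graph n) (χ : Colouring n k) → AllColoured G χ ⊎ ∃[ v ] Vec.lookup χ v ≡ nothing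
  allColoured-or-not G χ with any? (uncoloured? χ)
  ... | yes u = inj₂ u
  ... | no ¬u = inj₁ λ v → [ (λ eq → ⊥-elim (¬u (v , eq))) , (λ p → p) ]′ (coloured-or-not χ v)

module _ {n : ℕ} (G : Graph n) {k : ℕ} where
  open Graph G

  majority? : (χ : Colouring n k) → Dec (Majority G χ)
  majority? χ = all? λ v → all? λ c →
    ≡-dec _≟ᶠ_ (Vec.lookup χ v) (just c) →-dec (2 * neighboursColoured G χ v c ≤? degree v)

  legal? : ∀ (χ : Colouring n k) v c → Dec (Legal G χ v c)
  legal? χ v c = uncoloured? χ v ×-dec majority? (χ [ v ]≔ just c)

  blocked? : (χ : Colouring n k) → Dec (Blocked G χ)
  blocked? χ = any? λ v → uncoloured? χ v ×-dec all? λ c → ¬? (legal? χ v c)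

  -- Every move uses up an uncoloured vertex, so the game tree has depth at most `N` and can be
  -- searched by recursion on that bound.
  winningStrategy? : ∀ N p (χ : Colouring n k) → #uncoloured χ ≤ N → Dec (WinningStrategy G p χ)
  winningStrategy? N p χ bound with allColoured-or-not G χ
  ... | inj₁ full = yes (finished full)
  ... | inj₂ (v , eq) with blocked? χ
  ...   | yes bl = no λ where
          (finished full)         → contradiction (trans (sym (proj₂ (full v))) eq) λ ()
          (alice-move ¬bl _ _ _ _) → ¬bl bl
          (bob-move ¬bl _)        → ¬bl bl
  winningStrategy? zero p χ bound | inj₂ (v , eq) | no ¬bl =
    contradiction (≤-trans (count-≥ (uncoloured? χ) {v ∷ []} ([] ∷ []) (eq ∷ [])) bound) λ ()
  winningStrategy? (suc N) alice χ bound | inj₂ (v , eq) | no ¬bl =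
    mapDec (λ { (w , c , ok , win) → alice-move ¬bl w c ok win })
           (λ { (finished full) → contradiction (trans (sym (proj₂ (full v))) eq) λ ()
              ; (alice-move _ w c ok win) → w , c , ok , win })
           (any? λ w → any? λ c → option w c)
    where
    option : ∀ w c → Dec (Legal G χ w c × WinningStrategy G bob (χ [ w ]≔ just c))
    option w c with legal? χ w c
    ... | no ¬ok = no (¬ok ∘ proj₁)
    ... | yes ok = mapDec (ok ,_) proj₂ (winningStrategy? N bob (χ [ w ]≔ just c)
                      (≤-pred (≤-trans (#uncoloured-update χ c (proj₁ ok)) bound)))
  winningStrategy? (suc N) bob χ bound | inj₂ (v , eq) | no ¬bl =
    mapDec (bob-move ¬bl)
           (λ { (finished full) → contradiction (trans (sym (proj₂ (full v))) eq) λ ()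
              ; (bob-move _ win) → win })
           (all? λ w → all? λ c → option w c)
    where
    option : ∀ w c → Dec (Legal G χ w c → WinningStrategy G alice (χ [ w ]≔ just c))
    option w c with legal? χ w c
    ... | no ¬ok = yes λ ok → contradiction ok ¬ok
    ... | yes ok = mapDec (λ win _ → win) (λ f → f ok) (winningStrategy? N alice (χ [ w ]≔ just c)
                      (≤-pred (≤-trans (#uncoloured-update χ c (proj₁ ok)) bound)))

module _ {n : ℕ} (G : Graph n) where

  aliceWins? : Decidable (AliceWins G)
  aliceWins? k = winningStrategy? G _ alice (replicate n nothing) ≤-refl

-- A linear search upwards from zero, ending at `k` at the latest. It turns a win with three colours
-- into the existence of the least number together with its bound.
least-witness : ∀ {P : Pred ℕ 0ℓ} → Decidable P → ∀ k → P k →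
                ∃[ μ ] ((P μ × (∀ j → j < μ → ¬ P j)) × μ ≤ k)
least-witness P? zero    p = zero , (p , λ _ ()) , z≤n
least-witness P? (suc k) p with P? zero
... | yes p₀ = zero , (p₀ , λ _ ()) , z≤n
... | no ¬p₀ with least-witness (P? ∘ suc) k p
...   | μ , (pμ , min) , μ≤k = suc μ , (pμ , λ { zero _ → ¬p₀ ; (suc j) (s≤s j<μ) → min j j<μ }) , s≤s μ≤k

-- Spines

-- All that the strategy has to know of a caterpillar. Positions are plain numbers with bounds as
-- hypotheses, so that `i`, `suc i` and `2 + i` need no conversion between finite types.
record Spine {n : ℕ} (G : Graph n) : Set where
  open Graph G
  field
    last         : ℕ
    sp           : ℕ → Fin n
    sp-injective : ∀ {i j} → i ≤ last → j ≤ last → sp i ≡ sp j → i ≡ j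
    sp-step      : ∀ {i} → suc i ≤ last → sp i ~ sp (suc i)
    sp-near      : ∀ {i j} → i ≤ last → j ≤ last → sp i ~ sp j → j ≡ suc i ⊎ i ≡ suc j

  OffSpine : Fin n → Set
  OffSpine u = ∀ {i} → i ≤ last → u ≢ sp i

  field
    on-or-off       : ∀ u → (∃[ i ] (i ≤ last × u ≡ sp i)) ⊎ OffSpine u
    foot-unique     : ∀ {u i j} → OffSpine u → i ≤ last → j ≤ last → sp i ~ u → sp j ~ u → i ≡ j
    two-neighbours  : ∀ {u} → OffSpine u → ∃[ a ] ∃[ b ] (∀ w → u ~ w → w ≡ a ⊎ w ≡ b)

-- Positions beyond `m` are sent to `m`. This default never matters, since the fields of `Spine`
-- speak only of positions up to `last`.
clip : ∀ m → ℕ → Fin (suc m)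
clip m       zero    = zero
clip zero    (suc i) = zero
clip (suc m) (suc i) = suc (clip m i)

toℕ-clip : ∀ {m i} → i ≤ m → toℕ (clip m i) ≡ i
toℕ-clip z≤n       = refl
toℕ-clip (s≤s i≤m) = cong suc (toℕ-clip i≤m)

-- On a leg of length one the value is the vertex itself, a harmless default: `two-neighbours` only
-- asks for two vertices that include all neighbours.
other : ∀ l → Fin ⟦ l ⟧ → Fin ⟦ l ⟧
other one p          = p
other two zero       = suc zero
other two (suc zero) = zero

other-next : ∀ l (p q : Fin ⟦ l ⟧) → toℕ q ≡ suc (toℕ p) → q ≡ other l p × p ≡ other l q
other-next one zero       zero       ()
other-next two zero       zero       ()
other-next two zero       (suc zero) refl = refl , refl
other-next two (suc zero) zero       ()
other-next two (suc zero) (suc zero) ()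

caterpillar-spine : ∀ {n} {G : Graph n} → Is2Caterpillar G → Spine G
caterpillar-spine {n} {G} cat = record
  { last           = spineLength
  ; sp             = sp
  ; sp-injective   = λ {i} {j} i≤ j≤ eq → clip-inj i≤ j≤
                       (spine-inj (trans (sym (to-sp i)) (trans (cong to eq) (to-sp j))))
  ; sp-step        = λ {i} i<m → Equivalence.from (edges _ _) (fwd (step i i<m))
  ; sp-near        = λ {i} {j} i≤ j≤ e → near i≤ j≤ (to-edge (to-sp i) (to-sp j) e)
  ; on-or-off      = λ u → classify u (to u) refl
  ; foot-unique    = foot
  ; two-neighbours = two-nbrs
  }
  where
  open Graph G
  open Is2Caterpillar cat
  open CaterpillarShape shape
  open Bijection vertex using (to; to⁻; injective; strictlySurjective)

  V = Vertex shape

  to∘to⁻ : ∀ (x : V) → to (to⁻ x) ≡ x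
  to∘to⁻ x = proj₂ (strictlySurjective x)

  spine-inj : ∀ {i j} → spine {shape} i ≡ spine j → i ≡ j
  spine-inj refl = refl

  sp : ℕ → Fin n
  sp i = to⁻ (spine (clip spineLength i))

  clip-inj : ∀ {i j} → i ≤ spineLength → j ≤ spineLength → clip spineLength i ≡ clip spineLength j → i ≡ j
  clip-inj i≤ j≤ eq = trans (sym (toℕ-clip i≤)) (trans (cong toℕ eq) (toℕ-clip j≤))

  to-sp : ∀ i → to (sp i) ≡ spine (clip spineLength i)
  to-sp i = to∘to⁻ _

  to-edge : ∀ {u v x y} → to u ≡ x → to v ≡ y → u ~ v → SymClosure (Edge shape) x y
  to-edge refl refl = Equivalence.to (edges _ _)

  step : ∀ i → suc i ≤ spineLength → Edge shape (to (sp i)) (to (sp (suc i)))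
  step i i<m rewrite to-sp i | to-sp (suc i) =
    along-spine (trans (toℕ-clip i<m) (cong suc (sym (toℕ-clip (<⇒≤ i<m)))))

  near : ∀ {i j} → i ≤ spineLength → j ≤ spineLength →
         SymClosure (Edge shape) (spine (clip spineLength i)) (spine (clip spineLength j)) → j ≡ suc i ⊎ i ≡ suc j
  near i≤ j≤ (fwd (along-spine eq)) = inj₁ (trans (sym (toℕ-clip j≤)) (trans eq (cong suc (toℕ-clip i≤))))
  near i≤ j≤ (bwd (along-spine eq)) = inj₂ (trans (sym (toℕ-clip i≤)) (trans eq (cong suc (toℕ-clip j≤))))

  on-spine : ∀ u k → to u ≡ spine k → u ≡ sp (toℕ k)
  on-spine u k eq = injective (trans eq (trans (cong spine (toℕ-injective (sym (toℕ-clip k≤)))) (sym (to-sp (toℕ k)))))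
    where k≤ = ≤-pred (toℕ<n k)

  classify : ∀ u x → to u ≡ x → (∃[ i ] (i ≤ spineLength × u ≡ sp i)) ⊎ (∀ {i} → i ≤ spineLength → u ≢ sp i)
  classify u (spine k) eq = inj₁ (toℕ k , ≤-pred (toℕ<n k) , on-spine u k eq)
  classify u (leg i j p) eq = inj₂ λ {l} _ u≡ → case (trans (sym eq) (trans (cong to u≡) (to-sp l)))
    where
    case : ∀ {l} → leg {shape} i j p ≢ spine l
    case ()

  edge-foot : ∀ {k i j p} → SymClosure (Edge shape) (spine k) (leg i j p) → k ≡ i
  edge-foot (fwd (attach _)) = refl

  foot : ∀ {u i j} → (∀ {i} → i ≤ spineLength → u ≢ sp i) → i ≤ spineLength → j ≤ spineLength →
         sp i ~ u → sp j ~ u → i ≡ j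
  foot {u} {i} {j} off i≤ j≤ ei ej = go (to u) refl
    where
    go : ∀ x → to u ≡ x → i ≡ j
    go (spine k) eq = contradiction (on-spine u k eq) (off (≤-pred (toℕ<n k)))
    go (leg l q p) eq = clip-inj i≤ j≤
      (trans (edge-foot (to-edge (to-sp i) eq ei)) (sym (edge-foot (to-edge (to-sp j) eq ej))))

  leg-nbr : ∀ {i j p x} → SymClosure (Edge shape) (leg i j p) x → x ≡ spine i ⊎ x ≡ leg i j (other _ p)
  leg-nbr (fwd (along-leg eq)) = inj₂ (cong (leg _ _) (proj₁ (other-next _ _ _ eq)))
  leg-nbr (bwd (attach _))     = inj₁ refl
  leg-nbr (bwd (along-leg eq)) = inj₂ (cong (leg _ _) (proj₂ (other-next _ _ _ eq)))

  two-nbrs : ∀ {u} → (∀ {i} → i ≤ spineLength → u ≢ sp i) → ∃[ a ] ∃[ b ] (∀ w → u ~ w → w ≡ a ⊎ w ≡ b)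
  two-nbrs {u} off = go (to u) refl
    where
    go : ∀ x → to u ≡ x → ∃[ a ] ∃[ b ] (∀ w → u ~ w → w ≡ a ⊎ w ≡ b)
    go (spine k) eq = contradiction (on-spine u k eq) (off (≤-pred (toℕ<n k)))
    go (leg i j p) eq = to⁻ (spine i) , to⁻ (leg i j (other _ p)) , λ w e →
      map⊎ (λ q → injective (trans q (sym (to∘to⁻ _)))) (λ q → injective (trans q (sym (to∘to⁻ _))))
           (leg-nbr (to-edge eq refl e))

-- Saturated vertices facing each other

module Violations (U S : Pred ℕ 0ℓ) where

  -- With `U` read as uncoloured: no two consecutive coloured positions from `a` to `b`, both ends
  -- included.
  Clean : ℕ → ℕ → Set
  Clean a b = ∀ k → a ≤ k → k < b → U k ⊎ U (suc k)

  -- A violation without its far end `suc j`, kept separate because such stretches can be extended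
  -- and joined. The case of `j` equal to `suc a` is a single uncoloured position.
  record Reach (a j : ℕ) : Set where
    constructor reach
    field
      lt    : a < j
      sat   : S a
      first : U (suc a)
      final : U j
      clean : Clean (suc a) j

  Violation : ℕ → ℕ → Set
  Violation a j = Reach a j × S (suc j)

  -- At most one position is jumped over, and it lies between two uncoloured ones, so no two
  -- consecutive coloured positions arise.
  extend-reach : ∀ {a j q} → Reach a j → U q → suc j ≡ q ⊎ suc (suc j) ≡ q → Reach a q
  extend-reach {a} {j} (reach lt sat first final clean) Uq (inj₁ refl) =
    reach (m≤n⇒m≤1+n lt) sat first Uq clean′
    where
    clean′ : Clean (suc a) (suc j)
    clean′ k a<k (s≤s k≤j) with m≤n⇒m<n∨m≡n k≤j
    ... | inj₁ k<j  = clean k a<k k<j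
    ... | inj₂ refl = inj₁ final
  extend-reach {a} {j} (reach lt sat first final clean) Uq (inj₂ refl) =
    reach (m≤n⇒m≤1+n (m≤n⇒m≤1+n lt)) sat first Uq clean′
    where
    clean′ : Clean (suc a) (suc (suc j))
    clean′ k a<k (s≤s k≤1+j) with m≤n⇒m<n∨m≡n k≤1+j
    ... | inj₂ refl = inj₂ Uq
    ... | inj₁ (s≤s k≤j) with m≤n⇒m<n∨m≡n k≤j
    ...   | inj₁ k<j  = clean k a<k k<j
    ...   | inj₂ refl = inj₁ final

  -- At the seam only `b` can be coloured, namely when it is `suc q`, and then its neighbours `q`
  -- and `suc b` are uncoloured.
  join : ∀ {a q b j} → Reach a q → b ≡ q ⊎ b ≡ suc q → b < j → U (suc b) → U j → Clean (suc b) j → Reach a j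
  join {a} {q} {b} {j} (reach lt sat first final clean) b≈q b<j Ub Uj clean₂ =
    reach (≤-trans lt (≤-trans (q≤b b≈q) (<⇒≤ b<j))) sat first Uj clean′
    where
    q≤b : b ≡ q ⊎ b ≡ suc q → q ≤ b
    q≤b (inj₁ refl) = ≤-refl
    q≤b (inj₂ refl) = n≤1+n _
    middle : ∀ k → q ≤ k → k ≤ b → b ≡ q ⊎ b ≡ suc q → U k ⊎ U (suc k)
    middle k q≤k k≤b (inj₁ refl) = inj₁ (subst U (≤-antisym q≤k k≤b) final)
    middle k q≤k k≤b (inj₂ refl) with m≤n⇒m<n∨m≡n k≤b
    ... | inj₁ (s≤s k≤q) = inj₁ (subst U (≤-antisym q≤k k≤q) final)
    ... | inj₂ refl      = inj₂ Ub
    clean′ : Clean (suc a) j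
    clean′ k a<k k<j with k <? q | k ≤? b
    ... | yes k<q | _       = clean k a<k k<q
    ... | no k≮q  | yes k≤b = middle k (≮⇒≥ k≮q) k≤b b≈q
    ... | no _    | no k≰b  = clean₂ k (≰⇒> k≰b) k<j

  module _ (U? : Decidable U) (S? : Decidable S) where

    clean? : ∀ a b → Dec (Clean a b)
    clean? a b = mapDec (λ cl k a≤k k<b → cl k<b a≤k) (λ cl {k} k<b a≤k → cl k a≤k k<b)
      (allUpTo? (λ k → (a ≤? k) →-dec (U? k ⊎-dec U? (suc k))) b)

    reach? : ∀ a j → Dec (Reach a j)
    reach? a j = mapDec (λ { (lt , s , u , v , cl) → reach lt s u v cl })
                        (λ { (reach lt s u v cl) → lt , s , u , v , cl })
      ((a <? j) ×-dec S? a ×-dec U? (suc a) ×-dec U? j ×-dec clean? (suc a) j)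

    violation? : ∀ a j → Dec (Violation a j)
    violation? a j = reach? a j ×-dec S? (suc j)

-- Colours

avoid₂ : ∀ (a b : Maybe (Fin 3)) → ∃[ c ] (a ≢ just c × b ≢ just c)
avoid₂ nothing nothing = zero , (λ ()) , λ ()
avoid₂ nothing (just zero) = suc zero , (λ ()) , λ ()
avoid₂ nothing (just (suc _)) = zero , (λ ()) , λ ()
avoid₂ (just zero) nothing = suc zero , (λ ()) , λ ()
avoid₂ (just (suc _)) nothing = zero , (λ ()) , λ ()
avoid₂ (just (suc _)) (just (suc _)) = zero , (λ ()) , λ ()
avoid₂ (just zero) (just zero) = suc zero , (λ ()) , λ ()
avoid₂ (just zero) (just (suc zero)) = suc (suc zero) , (λ ()) , λ ()
avoid₂ (just zero) (just (suc (suc zero))) = suc zero , (λ ()) , λ ()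
avoid₂ (just (suc zero)) (just zero) = suc (suc zero) , (λ ()) , λ ()
avoid₂ (just (suc (suc zero))) (just zero) = suc zero , (λ ()) , λ ()

-- The second alternative is the forced case: `a`, `b` and `r` use up all three colours.
avoid₃ : ∀ (a b : Maybe (Fin 3)) r →
         (∃[ c ] (a ≢ just c × b ≢ just c × r ≢ c)) ⊎
         (∃[ p ] ∃[ q ] (a ≡ just p × b ≡ just q × p ≢ q × r ≢ p × r ≢ q))
avoid₃ nothing b r with avoid₂ b (just r)
... | c , b≢ , r≢ = inj₁ (c , (λ ()) , b≢ , r≢ ∘ cong just)
avoid₃ (just p) nothing r with avoid₂ (just p) (just r)
... | c , p≢ , r≢ = inj₁ (c , p≢ , (λ ()) , r≢ ∘ cong just)
avoid₃ (just p) (just q) r with p ≟ᶠ q | r ≟ᶠ p | r ≟ᶠ q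
... | no p≢q | no r≢p | no r≢q = inj₂ (p , q , refl , refl , p≢q , r≢p , r≢q)
... | yes refl | _ | _ = let c , p≢ , r≢ = avoid₂ (just p) (just r) in inj₁ (c , p≢ , p≢ , r≢ ∘ cong just)
... | no _ | yes refl | _ = let c , p≢ , q≢ = avoid₂ (just p) (just q) in inj₁ (c , p≢ , q≢ , p≢ ∘ cong just)
... | no _ | no _ | yes refl = let c , p≢ , q≢ = avoid₂ (just p) (just q) in inj₁ (c , p≢ , q≢ , q≢ ∘ cong just)

-- Moves

module Moves {n : ℕ} (G : Graph n) {k : ℕ} where
  open Graph G

  -- Written exactly as the filter inside `neighboursColoured`, so that the counting lemmas apply to
  -- it definitionally.
  coloured? : ∀ w d (ψ : Colouring n k) → Decidable (λ u → w ~ u × Vec.lookup ψ u ≡ just d)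
  coloured? w d ψ u = (w ~? u) ×-dec ≡-dec _≟ᶠ_ (Vec.lookup ψ u) (just d)

  module _ (χ : Colouring n k) (v : Fin n) (c : Fin k) where

    private
      χ′ : Colouring n k
      χ′ = χ [ v ]≔ just c

      old : ∀ {u d} → u ≢ v → Vec.lookup χ′ u ≡ just d → Vec.lookup χ u ≡ just d
      old u≢v eq = trans (sym (lookup∘update′ u≢v χ (just c))) eq

      new : ∀ {d} → Vec.lookup χ′ v ≡ just d → d ≡ c
      new eq = just-injective (trans (sym eq) (lookup∘update v χ (just c)))

    count-unchanged : ∀ w d → ¬ (w ~ v × d ≡ c) → neighboursColoured G χ′ w d ≤ neighboursColoured G χ w d
    count-unchanged w d ¬e = count-mono (coloured? w d χ′) (coloured? w d χ) keep
      where
      keep : ∀ u → w ~ u × Vec.lookup χ′ u ≡ just d → w ~ u × Vec.lookup χ u ≡ just d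
      keep u (e , eq) with u ≟ᶠ v
      ... | yes refl = contradiction (e , new eq) ¬e
      ... | no u≢v   = e , old u≢v eq

    count-grows : ∀ w d → neighboursColoured G χ′ w d ≤ suc (neighboursColoured G χ w d)
    count-grows w d = count-insert (coloured? w d χ′) (coloured? w d χ) v keep
      where
      keep : ∀ u → w ~ u × Vec.lookup χ′ u ≡ just d → u ≡ v ⊎ (w ~ u × Vec.lookup χ u ≡ just d)
      keep u (e , eq) with u ≟ᶠ v
      ... | yes u≡v = inj₁ u≡v
      ... | no u≢v  = inj₂ (e , old u≢v eq)

    Fresh : Set
    Fresh = ∀ u → v ~ u → Vec.lookup χ u ≢ just c

    count-fresh : Fresh → neighboursColoured G χ′ v c ≤ 0
    count-fresh fresh = count-≤ (coloured? v c χ′) [] none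
      where
      none : ∀ u → v ~ u × Vec.lookup χ′ u ≡ just c → u ∈ []
      none u (e , eq) with u ≟ᶠ v
      ... | yes refl = contradiction e (~-irrefl refl)
      ... | no u≢v   = contradiction (old u≢v eq) (fresh u e)

    -- Colouring `v` with `c` can raise a count only at `v` itself and at neighbours of `v` coloured
    -- `c`; everywhere else the old bound survives.
    majority-update : Majority G χ → 2 * neighboursColoured G χ′ v c ≤ degree v →
                      (∀ w → w ~ v → Vec.lookup χ w ≡ just c → 2 * suc (neighboursColoured G χ w c) ≤ degree w) →
                      Majority G χ′
    majority-update maj at-v at-nbrs w d eq with w ≟ᶠ v
    ... | yes refl rewrite new eq = at-v
    ... | no w≢v with (w ~? v) ×-dec (d ≟ᶠ c)
    ...   | yes (e , refl) = ≤-trans (*-monoʳ-≤ 2 (count-grows w c)) (at-nbrs w e (old w≢v eq))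
    ...   | no ¬e          = ≤-trans (*-monoʳ-≤ 2 (count-unchanged w d ¬e)) (maj w d (old w≢v eq))

    fresh-majority : Majority G χ → Fresh → Majority G χ′
    fresh-majority maj fresh = majority-update maj (≤-trans (*-monoʳ-≤ 2 (count-fresh fresh)) z≤n)
      λ w e eq → contradiction eq (fresh w (~-sym e))

    -- `v` gets at most one neighbour of its own colour, so degree two suffices there. The only
    -- other vertex at risk is `u`, which can take one more by `room`.
    matching-majority : ∀ u → Majority G χ → 2 ≤ degree v →
                        (∀ w → v ~ w → Vec.lookup χ w ≡ just c → w ≡ u) →
                        2 * suc (neighboursColoured G χ u c) ≤ degree u →
                        Majority G χ′
    matching-majority u maj deg≥2 only room = majority-update maj
      (≤-trans (*-monoʳ-≤ 2 (count-≤ (coloured? v c χ′) (u ∷ []) matches)) deg≥2)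
      λ w e eq → subst (λ z → 2 * suc (neighboursColoured G χ z c) ≤ degree z) (sym (only w (~-sym e) eq)) room
      where
      matches : ∀ w → v ~ w × Vec.lookup χ′ w ≡ just c → w ∈ u ∷ []
      matches w (e , eq) with w ≟ᶠ v
      ... | yes refl = contradiction e (~-irrefl refl)
      ... | no w≢v   = here (only w e (old w≢v eq))

  Saturated : Colouring n k → Fin n → Set
  Saturated χ w = ∃[ d ] (Vec.lookup χ w ≡ just d × degree w < 2 * suc (neighboursColoured G χ w d))

  saturated? : ∀ χ → Decidable (Saturated χ)
  saturated? χ w = any? λ d →
    ≡-dec _≟ᶠ_ (Vec.lookup χ w) (just d) ×-dec (degree w <? 2 * suc (neighboursColoured G χ w d))

  saturated-update : ∀ χ v c {w} → w ≢ v → Saturated (χ [ v ]≔ just c) w →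
                     Saturated χ w ⊎ (w ~ v × Vec.lookup χ w ≡ just c)
  saturated-update χ v c {w} w≢v (d , eq , full) with (w ~? v) ×-dec (d ≟ᶠ c)
  ... | yes (e , refl) = inj₂ (e , trans (sym (lookup∘update′ w≢v χ (just c))) eq)
  ... | no ¬e = inj₁ (d , trans (sym (lookup∘update′ w≢v χ (just c))) eq ,
                      ≤-trans full (*-monoʳ-≤ 2 (s≤s (count-unchanged χ v c w d ¬e))))

  -- With no neighbour of its own colour, a vertex needs degree two to afford one more; a coloured
  -- vertex of degree one is always saturated.
  fresh-unsaturated : ∀ χ v c → Fresh χ v c → 2 ≤ degree v → ¬ Saturated (χ [ v ]≔ just c) v
  fresh-unsaturated χ v c fresh deg≥2 (d , eq , full)
    rewrite just-injective (trans (sym eq) (lookup∘update v χ (just c))) =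
    <⇒≱ full (≤-trans (*-monoʳ-≤ 2 (s≤s (count-fresh χ v c fresh))) deg≥2)

  degree≥2 : ∀ {v a b} → v ~ a → v ~ b → a ≢ b → 2 ≤ degree v
  degree≥2 {v} {a} {b} ea eb a≢b = count-≥ (v ~?_) {a ∷ b ∷ []} ((a≢b ∷ []) ∷ [] ∷ []) (ea ∷ eb ∷ [])

  degree≥4 : ∀ {v a b c d} → v ~ a → v ~ b → v ~ c → v ~ d →
             a ≢ b → a ≢ c → a ≢ d → b ≢ c → b ≢ d → c ≢ d → 4 ≤ degree v
  degree≥4 {v} {a} {b} {c} {d} ea eb ec ed ab ac ad bc bd cd = count-≥ (v ~?_) {a ∷ b ∷ c ∷ d ∷ []}
    ((ab ∷ ac ∷ ad ∷ []) ∷ (bc ∷ bd ∷ []) ∷ (cd ∷ []) ∷ [] ∷ []) (ea ∷ eb ∷ ec ∷ ed ∷ [])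

-- Alice's strategy

module Strategy {n : ℕ} (G : Graph n) (spine : Spine G) where
  open Graph G
  open Spine spine
  open Moves G {3}

  Position : Set
  Position = Colouring n 3

  -- U: uncoloured positions of the spine; S: positions whose neighbours can no
  -- longer receive the same colour.
  U S : Position → Pred ℕ 0ℓ
  U χ i = i ≤ last × Vec.lookup χ (sp i) ≡ nothing
  S χ i = i ≤ last × Saturated χ (sp i)

  U? : ∀ χ → Decidable (U χ)
  U? χ i = (i ≤? last) ×-dec uncoloured? χ (sp i)

  S? : ∀ χ → Decidable (S χ)
  S? χ i = (i ≤? last) ×-dec saturated? χ (sp i)

  module V (χ : Position) = Violations (U χ) (S χ)
  open Violations using (Clean; Reach; reach; Violation)

  LegsFree : Position → ℕ → Set
  LegsFree χ i = ∀ u → OffSpine u → sp i ~ u → Vec.lookup χ u ≡ nothing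

  -- A coloured vertex between two uncoloured ones threatens both of them once it
  -- is saturated, so Bob must not be able to saturate it by a single leg move.
  Robust : Position → ℕ → Set
  Robust χ l = ∀ c → U χ l → Vec.lookup χ (sp (suc l)) ≡ just c → U χ (2 + l) →
               ∀ u → OffSpine u → sp (suc l) ~ u → Vec.lookup χ u ≡ nothing →
               2 * (2 + neighboursColoured G χ (sp (suc l)) c) ≤ degree (sp (suc l))

  record Invariant (χ : Position) : Set where
    field
      majority     : Majority G χ
      -- With position `0` coloured, every uncoloured spine position has the form `suc i` and a left
      -- neighbour `i`.
      started      : ¬ U χ 0
      no-violation : ∀ a j → ¬ Violation (U χ) (S χ) a j
      robust       : ∀ l → Robust χ l
      legs-free    : ∀ i → U χ i → LegsFree χ i

  Reply : Position → Set
  Reply χ = ∃[ v ] ∃[ c ] (Legal G χ v c × Invariant (χ [ v ]≔ just c))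

  -- Effect of a single move on the parts of the invariant

  S-not-U : ∀ χ {i} → S χ i → ¬ U χ i
  S-not-U χ (_ , _ , eq , _) (_ , eq′) = contradiction (trans (sym eq) eq′) λ ()

  coloured-not-U : ∀ χ {i c} → Vec.lookup χ (sp i) ≡ just c → ¬ U χ i
  coloured-not-U χ eq (_ , eq′) = contradiction (trans (sym eq) eq′) λ ()

  U-update : ∀ χ v c {i} → U (χ [ v ]≔ just c) i → sp i ≢ v × U χ i
  U-update χ v c (i≤ , eq) = let ne , eq′ = uncoloured-update χ eq in ne , i≤ , eq′

  U-keep : ∀ χ v c {i} → sp i ≢ v → U χ i → U (χ [ v ]≔ just c) i
  U-keep χ v c ne (i≤ , eq) = i≤ , trans (lookup∘update′ ne χ (just c)) eq

  S-update : ∀ χ v c {i} → sp i ≢ v → S (χ [ v ]≔ just c) i → S χ i ⊎ (sp i ~ v × Vec.lookup χ (sp i) ≡ just c)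
  S-update χ v c ne (i≤ , sat) with saturated-update χ v c ne sat
  ... | inj₁ s = inj₁ (i≤ , s)
  ... | inj₂ p = inj₂ p

  sp≢ : ∀ {i j} → i ≤ last → j ≤ last → i ≢ j → sp i ≢ sp j
  sp≢ i≤ j≤ ne = ne ∘ sp-injective i≤ j≤

  degree≥2-inner : ∀ {i} → 2 + i ≤ last → 2 ≤ degree (sp (suc i))
  degree≥2-inner {i} i< = degree≥2 (~-sym (sp-step (<⇒≤ i<))) (sp-step i<)
    (sp≢ (<⇒≤ (<⇒≤ i<)) i< λ ())

  spine-fresh : ∀ χ i c → suc i ≤ last → Vec.lookup χ (sp i) ≢ just c →
                (2 + i ≤ last → Vec.lookup χ (sp (2 + i)) ≢ just c) →
                (∀ u → OffSpine u → sp (suc i) ~ u → Vec.lookup χ u ≢ just c) →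
                Fresh χ (sp (suc i)) c
  spine-fresh χ i c i< left right legs u e with on-or-off u
  ... | inj₂ off = legs u off e
  ... | inj₁ (j , j≤ , refl) with sp-near i< j≤ e
  ...   | inj₁ refl = right j≤
  ...   | inj₂ refl = left

  -- Past the end of the spine the value is `nothing`, so that a missing neighbour forbids no
  -- colour.
  rightColour : Position → ℕ → Maybe (Fin 3)
  rightColour χ i with i ≤? last
  ... | yes _ = Vec.lookup χ (sp i)
  ... | no _  = nothing

  rightColour-≢ : ∀ χ i {c} → rightColour χ i ≢ just c → i ≤ last → Vec.lookup χ (sp i) ≢ just c
  rightColour-≢ χ i ne i≤ with i ≤? last
  ... | yes _ = ne
  ... | no i≰ = contradiction i≤ i≰

  rightColour-≡ : ∀ χ i {c} → rightColour χ i ≡ just c → i ≤ last × Vec.lookup χ (sp i) ≡ just c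
  rightColour-≡ χ i eq with i ≤? last
  ... | yes i≤ = i≤ , eq
  rightColour-≡ χ i () | no _

  -- Only the two spine neighbours can be coloured, and they forbid at most two of the three
  -- colours.
  free-colour : ∀ χ i → suc i ≤ last → LegsFree χ (suc i) → ∃[ c ] Fresh χ (sp (suc i)) c
  free-colour χ i i< free =
    let c , left , right = avoid₂ (Vec.lookup χ (sp i)) (rightColour χ (2 + i)) in
    c , spine-fresh χ i c i< left (rightColour-≢ χ (2 + i) right)
          λ u off e eq → contradiction (trans (sym eq) (free u off e)) λ ()

  off-colour : ∀ χ u → OffSpine u → ∃[ c ] Fresh χ u c
  off-colour χ u off =
    let a , b , nbrs = two-neighbours off
        c , a≢ , b≢ = avoid₂ (Vec.lookup χ a) (Vec.lookup χ b) in
    c , λ w e → [ (λ { refl → a≢ }) , (λ { refl → b≢ }) ]′ (nbrs w e)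

  -- Off the spine a colour is free by degree, on the spine because the legs are uncoloured. The
  -- alternative of an explicit legal colour serves the vertex whose leg Bob has just coloured.
  not-blocked : ∀ χ → Majority G χ → ¬ U χ 0 →
                (∀ i → U χ i → LegsFree χ i ⊎ ∃[ c ] Legal G χ (sp i) c) → ¬ Blocked G χ
  not-blocked χ maj started free (v , unc , stuck) with on-or-off v
  ... | inj₂ off = let c , fresh = off-colour χ v off in stuck c (unc , fresh-majority χ v c maj fresh)
  ... | inj₁ (zero , i≤ , refl) = started (i≤ , unc)
  ... | inj₁ (suc i , i≤ , refl) with free (suc i) (i≤ , unc)
  ...   | inj₂ (c , ok) = stuck c ok
  ...   | inj₁ fr = let c , fresh = free-colour χ i i≤ fr in stuck c (unc , fresh-majority χ v c maj fresh)

  legs-free-spine : ∀ χ q c {i} → q ≤ last → LegsFree χ i → LegsFree (χ [ sp q ]≔ just c) i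
  legs-free-spine χ q c q≤ free u off e = trans (lookup∘update′ (off q≤) χ (just c)) (free u off e)

  legs-free-off : ∀ χ b c {i} → ¬ sp i ~ b → LegsFree χ i → LegsFree (χ [ b ]≔ just c) i
  legs-free-off χ b c ¬e free u off e = trans (lookup∘update′ (λ { refl → ¬e e }) χ (just c)) (free u off e)

  robust-far : ∀ χ v c l → sp (suc l) ≢ v → ¬ sp (suc l) ~ v → Robust χ l → Robust (χ [ v ]≔ just c) l
  robust-far χ v c l ne ¬e rob d Ul col Ur u off e unc =
    ≤-trans (*-monoʳ-≤ 2 (s≤s (s≤s (count-unchanged χ v c (sp (suc l)) d (¬e ∘ proj₁)))))
      (rob d (proj₂ (U-update χ v c Ul)) (trans (sym (lookup∘update′ ne χ (just c))) col)
           (proj₂ (U-update χ v c Ur)) u off e (proj₂ (uncoloured-update χ unc)))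

  -- If `q` is `l` or `2 + l`, an outer position is now coloured and the condition is vacuous;
  -- otherwise `sp q` is not adjacent to the centre `sp (suc l)`.
  robust-spine : ∀ χ q c l → q ≤ last → suc l ≢ q → (l ≢ q → 2 + l ≢ q → Robust χ l) →
                 Robust (χ [ sp q ]≔ just c) l
  robust-spine χ q c l q≤ ne rob d Ul col Ur =
    robust-far χ (sp q) c l (sp≢ (<⇒≤ (proj₁ Ur)) q≤ ne) far (rob l≢q r≢q) d Ul col Ur
    where
    l≢q : l ≢ q
    l≢q refl = proj₁ (U-update χ (sp q) c Ul) refl
    r≢q : 2 + l ≢ q
    r≢q refl = proj₁ (U-update χ (sp q) c Ur) refl
    far : ¬ sp (suc l) ~ sp q
    far e with sp-near (<⇒≤ (proj₁ Ur)) q≤ e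
    ... | inj₁ eq = r≢q (sym eq)
    ... | inj₂ eq = l≢q (suc-injective eq)

  -- Robustness centred at a spine neighbour of the new vertex becomes vacuous, which explains two
  -- of the exceptions; the condition centred at the vertex itself is supplied separately.
  invariant-spine : ∀ χ i c → suc i ≤ last → Majority G (χ [ sp (suc i) ]≔ just c) → ¬ U χ 0 →
    (∀ l → l ≢ suc i → suc l ≢ i → l ≢ i → Robust χ l) →
    Robust (χ [ sp (suc i) ]≔ just c) i →
    (∀ j → j ≢ suc i → U χ j → LegsFree χ j) →
    (∀ a j → ¬ Violation (U (χ [ sp (suc i) ]≔ just c)) (S (χ [ sp (suc i) ]≔ just c)) a j) →
    Invariant (χ [ sp (suc i) ]≔ just c)
  invariant-spine χ i c i< maj started rob robᵢ free noviol = record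
    { majority     = maj
    ; started      = started ∘ proj₂ ∘ U-update χ v c
    ; no-violation = noviol
    ; robust       = robust′
    ; legs-free    = λ j Uj → let ne , Uj′ = U-update χ v c Uj in
                       legs-free-spine χ (suc i) c i< (free j (λ { refl → ne refl }) Uj′)
    }
    where
    v = sp (suc i)
    robust′ : ∀ l → Robust (χ [ v ]≔ just c) l
    robust′ l with l ≟ i
    ... | yes refl = robᵢ
    ... | no l≢i   = robust-spine χ (suc i) c l i< (l≢i ∘ suc-injective) λ l≢ r≢ → rob l l≢ (r≢ ∘ cong suc) l≢i

  reach-back : ∀ χ v c {a j} → S χ a → Reach (U (χ [ v ]≔ just c)) (S (χ [ v ]≔ just c)) a j → Reach (U χ) (S χ) a j
  reach-back χ v c Sa (reach lt _ first final clean) =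
    reach lt Sa (back first) (back final) λ k p q → map⊎ back back (clean k p q)
    where
    back : ∀ {i} → U (χ [ v ]≔ just c) i → U χ i
    back = proj₂ ∘ U-update χ v c

  -- Colouring an uncoloured vertex next to a coloured one creates two consecutive
  -- coloured vertices, which cuts every violation running across it.
  fill : ∀ χ i → Majority G χ → ¬ U χ 0 → (∀ j → U χ j → LegsFree χ j) → U χ (suc i) →
         ¬ U χ i ⊎ (2 + i ≤ last × ¬ U χ (2 + i)) →
         (∀ l → l ≢ suc i → suc l ≢ i → Robust χ l) →
         (∀ a j → Violation (U χ) (S χ) a j → a < suc i × suc i ≤ j) →
         Reply χ
  fill χ i maj started free Uv@(i< , unc) adj rob viol with free-colour χ i i< (free (suc i) Uv)
  ... | c , fresh = v , c , (unc , maj′) ,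
        invariant-spine χ i c i< maj′ started (λ l l≢ r≢ _ → rob l l≢ r≢)
          (λ d Ul _ Ur → ⊥-elim (not-both Ul Ur)) (λ j _ → free j) no-viol
    where
    v = sp (suc i)
    χ′ = χ [ v ]≔ just c
    maj′ = fresh-majority χ v c maj fresh
    not-both : U χ′ i → ¬ U χ′ (2 + i)
    not-both Ul Ur = [ (λ ¬Ul → ¬Ul (proj₂ (U-update χ v c Ul)))
                     , (λ (_ , ¬Ur) → ¬Ur (proj₂ (U-update χ v c Ur))) ]′ adj
    not-v : ∀ {j} → U χ′ j → j ≢ suc i
    not-v Uj refl = proj₁ (U-update χ v c Uj) refl
    unsat : 2 + i ≤ last → ¬ S χ′ (suc i)
    unsat i<< (_ , sat) = fresh-unsaturated χ v c fresh (degree≥2-inner i<<) sat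
    S-old : ∀ {j} → j ≢ suc i → S χ′ j → S χ j
    S-old j≢ Sj with S-update χ v c (sp≢ (proj₁ Sj) i< j≢) Sj
    ... | inj₁ Sj′      = Sj′
    ... | inj₂ (e , eq) = contradiction eq (fresh _ (~-sym e))
    no-viol : ∀ a j → ¬ Violation (U χ′) (S χ′) a j
    no-viol a j (R@(reach lt Sa first final clean) , Sj) =
      not-both Ui Ui+2
      where
      -- As a left end the vertex would have a right neighbour, hence degree at least two, and its
      -- fresh colour leaves it unsaturated.
      a≢ : a ≢ suc i
      a≢ refl = unsat (proj₁ first) Sa
      j≢ : suc j ≢ suc i
      j≢ refl = [ (λ ¬Ui → ¬Ui (proj₂ (U-update χ v c final))) , (λ (i<< , _) → unsat i<< Sj) ]′ adj
      inside = viol a j (reach-back χ v c (S-old a≢ Sa) R , S-old j≢ Sj)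
      a<i : suc a ≤ i
      a<i = ≤∧≢⇒< (≤-pred (proj₁ inside)) (not-v first ∘ cong suc)
      i<j : suc i < j
      i<j = ≤∧≢⇒< (proj₂ inside) (not-v final ∘ sym)
      -- Cleanness of the two pairs containing the new vertex forces both its neighbours to be
      -- uncoloured, against `adj`.
      Ui : U χ′ i
      Ui with clean i a<i (<⇒≤ i<j)
      ... | inj₁ u = u
      ... | inj₂ u = contradiction refl (not-v u)
      Ui+2 : U χ′ (2 + i)
      Ui+2 with clean (suc i) (m≤n⇒m≤1+n a<i) i<j
      ... | inj₁ u = contradiction refl (not-v u)
      ... | inj₂ u = u

  boundary : ∀ χ → ¬ U χ 0 → ∀ j → U χ j → ∃[ i ] (U χ (suc i) × ¬ U χ i)
  boundary χ started zero    Uj = contradiction Uj started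
  boundary χ started (suc j) Uj with U? χ j
  ... | yes Uj′ = boundary χ started j Uj′
  ... | no ¬Uj  = j , Uj , ¬Uj

  -- The case of a spare tempo: the invariant already holds with Alice to move. Once the spine is
  -- full, every clause except majority is vacuous.
  free-move : ∀ χ → Invariant χ → AllColoured G χ ⊎ Reply χ
  free-move χ inv with anyUpTo? (U? χ) (suc last)
  ... | yes (j , _ , Uj) with boundary χ (Invariant.started inv) j Uj
  ...   | i , Ui , ¬Ui = inj₂ (fill χ i majority started legs-free Ui (inj₁ ¬Ui) (λ l _ _ → robust l)
                                 λ a j vi → contradiction vi (no-violation a j))
    where open Invariant inv
  free-move χ inv | no none with allColoured-or-not G χ
  ... | inj₁ full = inj₁ full
  ... | inj₂ (v , unc) with on-or-off v
  ...   | inj₁ (i , i≤ , refl) = contradiction (i , s≤s i≤ , i≤ , unc) none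
  ...   | inj₂ off with off-colour χ v off
  ...     | c , fresh = inj₂ (v , c , (unc , maj′) , record
            { majority     = maj′
            ; started      = noU
            ; no-violation = λ { a j (R , _) → noU (Reach.first R) }
            ; robust       = λ l d Ul → contradiction Ul noU
            ; legs-free    = λ j Uj → contradiction Uj noU
            })
    where
    maj′ = fresh-majority χ v c (Invariant.majority inv) fresh
    noU : ∀ {i} → ¬ U (χ [ v ]≔ just c) i
    noU {i} Ui = none (i , s≤s (proj₁ Ui) , proj₂ (U-update χ v c Ui))

  -- Bob colours a leg vertex with no uncoloured spine neighbour

  AfterBob : Position → Set
  AfterBob χ = ¬ Blocked G χ × (AllColoured G χ ⊎ Reply χ)

  module _ (χ : Position) (inv : Invariant χ) (b : Fin n) (x : Fin 3) (unc : Vec.lookup χ b ≡ nothing)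
           (maj₁ : Majority G (χ [ b ]≔ just x)) where
    open Invariant inv

    private
      χ₁ : Position
      χ₁ = χ [ b ]≔ just x

      started₁ : ¬ U χ₁ 0
      started₁ = started ∘ proj₂ ∘ U-update χ b x

      back : ∀ {j} → U χ₁ j → U χ j
      back = proj₂ ∘ U-update χ b x

    -- This is the outer vertex of a leg of length two: no spine vertex sees it, so the invariant
    -- survives.
    after-inert : OffSpine b → (∀ {i} → i ≤ last → ¬ sp i ~ b) → AfterBob χ₁
    after-inert off no-foot = not-blocked χ₁ maj₁ started₁ (λ i Ui → inj₁ (legs-free₁ i Ui)) , free-move χ₁ record
      { majority     = maj₁
      ; started      = started₁
      ; no-violation = λ { a j (R , Sj) → no-violation a j (reach-back χ b x (S-old (Reach.sat R)) R , S-old Sj) }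
      ; robust       = λ l d Ul col Ur → robust-far χ b x l (off (<⇒≤ (proj₁ Ur)) ∘ sym)
                         (no-foot (<⇒≤ (proj₁ Ur))) (robust l) d Ul col Ur
      ; legs-free    = legs-free₁
      }
      where
      S-old : ∀ {j} → S χ₁ j → S χ j
      S-old Sj with S-update χ b x (off (proj₁ Sj) ∘ sym) Sj
      ... | inj₁ Sj′     = Sj′
      ... | inj₂ (e , _) = contradiction e (no-foot (proj₁ Sj))
      legs-free₁ : ∀ i → U χ₁ i → LegsFree χ₁ i
      legs-free₁ i Ui = legs-free-off χ b x (no-foot (proj₁ Ui)) (legs-free i (back Ui))

    -- Only the saturation of `i` can change. If both its spine neighbours are uncoloured,
    -- robustness has kept it unsaturated. If exactly one is, each new violation passes through that
    -- neighbour, which is filled. If none is, no violation arises.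
    after-leg : ∀ i → OffSpine b → i ≤ last → sp i ~ b → ¬ U χ i → AfterBob χ₁
    after-leg i off i≤ e ¬Ui = not-blocked χ₁ maj₁ started₁ (λ j Uj → inj₁ (legs-free₁ j Uj)) , reply
      where
      same-foot : ∀ {j} → j ≤ last → sp j ~ b → j ≡ i
      same-foot j≤ e′ = foot-unique off j≤ i≤ e′ e
      S-old : ∀ {j} → j ≢ i → S χ₁ j → S χ j
      S-old j≢ Sj with S-update χ b x (off (proj₁ Sj) ∘ sym) Sj
      ... | inj₁ Sj′      = Sj′
      ... | inj₂ (e′ , _) = contradiction (same-foot (proj₁ Sj) e′) j≢
      legs-free₁ : ∀ j → U χ₁ j → LegsFree χ₁ j
      legs-free₁ j Uj = legs-free-off χ b x
        (λ e′ → ¬Ui (subst (U χ) (same-foot (proj₁ Uj) e′) (back Uj))) (legs-free j (back Uj))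
      robust₁ : ∀ l → suc l ≢ i → Robust χ₁ l
      robust₁ l ne d Ul col Ur = robust-far χ b x l (off (<⇒≤ (proj₁ Ur)) ∘ sym)
        (ne ∘ same-foot (<⇒≤ (proj₁ Ur))) (robust l) d Ul col Ur
      forward : ∀ {j} → U χ j → U χ₁ j
      forward Uj = U-keep χ b x (off (proj₁ Uj) ∘ sym) Uj
      pivot-unsat : ∀ l → suc l ≡ i → U χ l → U χ (2 + l) → ¬ S χ₁ i
      pivot-unsat l refl Ul Ur (_ , d , col , full) = <⇒≱ full
        (≤-trans (*-monoʳ-≤ 2 (s≤s (count-grows χ b x (sp i) d)))
          (robust l d Ul (trans (sym (lookup∘update′ (off i≤ ∘ sym) χ (just x))) col) Ur b off e unc))

      reply : AllColoured G χ₁ ⊎ Reply χ₁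
      reply with U? χ (suc i)
      ... | yes Ur = inj₂ (fill χ₁ i maj₁ started₁ legs-free₁ (forward Ur) (inj₁ (¬Ui ∘ back))
                             (λ l _ ne → robust₁ l ne) inside)
        where
        inside : ∀ a j → Violation (U χ₁) (S χ₁) a j → a < suc i × suc i ≤ j
        inside a j (R , Sj) with a ≟ i | suc j ≟ i
        ... | yes refl | _        = ≤-refl , Reach.lt R
        ... | no _     | yes refl = contradiction Sj (pivot-unsat j refl (back (Reach.final R)) Ur)
        ... | no a≢    | no j≢    =
          contradiction (reach-back χ b x (S-old a≢ (Reach.sat R)) R , S-old j≢ Sj) (no-violation a j)
      ... | no ¬Ur with left-neighbour i
        where
        -- `fill` takes its vertex in the form `suc l`; for `i` equal to one the left neighbour is
        -- position `0`, which is coloured.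
        left-neighbour : ∀ i → (∃[ l ] (i ≡ 2 + l × U χ (suc l))) ⊎ (∀ l → suc l ≡ i → ¬ U χ l)
        left-neighbour zero          = inj₂ λ _ ()
        left-neighbour (suc zero)    = inj₂ λ { .0 refl → started }
        left-neighbour (suc (suc l)) with U? χ (suc l)
        ... | yes Ul = inj₁ (l , refl , Ul)
        ... | no ¬Ul = inj₂ λ { .(suc l) refl → ¬Ul }
      ...   | inj₁ (l , refl , Ul) = inj₂ (fill χ₁ l maj₁ started₁ legs-free₁ (forward Ul) (inj₂ (i≤ , ¬Ui ∘ back))
                                            (λ l′ ne _ → robust₁ l′ (ne ∘ suc-injective)) inside)
        where
        inside : ∀ a j → Violation (U χ₁) (S χ₁) a j → a < suc l × suc l ≤ j
        inside a j (R , Sj) with a ≟ i | suc j ≟ i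
        ... | yes refl | _        = contradiction (back (Reach.first R)) ¬Ur
        ... | no _     | yes refl = Reach.lt R , ≤-refl
        ... | no a≢    | no j≢    =
          contradiction (reach-back χ b x (S-old a≢ (Reach.sat R)) R , S-old j≢ Sj) (no-violation a j)
      ...   | inj₂ ¬Ul = free-move χ₁ record
        { majority     = maj₁
        ; started      = started₁
        ; no-violation = no-viol
        ; robust       = robust′
        ; legs-free    = legs-free₁
        }
        where
        robust′ : ∀ l → Robust χ₁ l
        robust′ l d Ul with suc l ≟ i
        ... | yes eq = contradiction (back Ul) (¬Ul l eq)
        ... | no ne  = robust₁ l ne d Ul
        no-viol : ∀ a j → ¬ Violation (U χ₁) (S χ₁) a j
        no-viol a j (R , Sj) with a ≟ i | suc j ≟ i
        ... | yes refl | _        = ¬Ur (back (Reach.first R))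
        ... | no _     | yes eq   = ¬Ul j eq (back (Reach.final R))
        ... | no a≢    | no j≢    = no-violation a j (reach-back χ b x (S-old a≢ (Reach.sat R)) R , S-old j≢ Sj)

  -- Bob moves at, or on a leg next to, an uncoloured spine vertex

  module _ (χ : Position) (inv : Invariant χ) (i : ℕ) (Uq : U χ (suc i)) where
    open Invariant inv

    private
      q≤ : suc i ≤ last
      q≤ = proj₁ Uq

    after-spine : ∀ x → Majority G (χ [ sp (suc i) ]≔ just x) → AfterBob (χ [ sp (suc i) ]≔ just x)
    after-spine x maj₁ = not-blocked χ₁ maj₁ started₁ (λ j Uj → inj₁ (legs-free₁ j Uj)) , reply
      where
      b = sp (suc i)
      χ₁ = χ [ b ]≔ just x
      back : ∀ {j} → U χ₁ j → U χ j
      back = proj₂ ∘ U-update χ b x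
      started₁ : ¬ U χ₁ 0
      started₁ = started ∘ back
      legs-free₁ : ∀ j → U χ₁ j → LegsFree χ₁ j
      legs-free₁ j Uj = legs-free-spine χ (suc i) x q≤ (legs-free j (back Uj))
      ¬U₁q : ¬ U χ₁ (suc i)
      ¬U₁q Uj = proj₁ (U-update χ b x Uj) refl
      robust₁ : ∀ l → l ≢ i → Robust χ₁ l
      robust₁ l ne = robust-spine χ (suc i) x l q≤ (ne ∘ suc-injective) λ _ _ → robust l
      S-old : ∀ {j} → j ≢ suc i → S χ₁ j → S χ j ⊎ j ≡ i ⊎ j ≡ 2 + i
      S-old j≢ Sj with S-update χ b x (sp≢ (proj₁ Sj) q≤ j≢) Sj
      ... | inj₁ Sj′ = inj₁ Sj′
      ... | inj₂ (e , _) with sp-near (proj₁ Sj) q≤ e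
      ...   | inj₁ eq = inj₂ (inj₁ (sym (suc-injective eq)))
      ...   | inj₂ eq = inj₂ (inj₂ eq)

      -- The near end is Bob's vertex or its spine neighbour on the given side; the far end was
      -- saturated before his move.
      Rightwards Leftwards : ℕ → ℕ → Set
      Rightwards a j = (a ≡ suc i ⊎ a ≡ 2 + i) × S χ (suc j)
      Leftwards  a j = (suc j ≡ suc i ⊎ 2 + j ≡ suc i) × S χ a

      -- Only `suc i`, `i` and `2 + i` can be newly saturated, and a violation with no such end
      -- would be old. Neither `i` as a left end nor `2 + i` as a right end is possible, since Bob's
      -- vertex beside it is coloured.
      side : ∀ a j → Violation (U χ₁) (S χ₁) a j → Rightwards a j ⊎ Leftwards a j
      side a j (R@(reach lt Sa first final _) , Sj) = go (a ≟ suc i) (suc j ≟ suc i)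
        where
        right-old : suc i ≤ a → S χ (suc j)
        right-old q≤a with S-old (>⇒≢ (s≤s (≤-trans q≤a (<⇒≤ lt)))) Sj
        ... | inj₁ Sj′         = Sj′
        ... | inj₂ (inj₁ refl) = contradiction (≤-trans (m≤n⇒m≤1+n (m≤n⇒m≤1+n lt)) q≤a) (<-irrefl refl)
        ... | inj₂ (inj₂ refl) = contradiction final ¬U₁q
        go : Dec (a ≡ suc i) → Dec (suc j ≡ suc i) → Rightwards a j ⊎ Leftwards a j
        go (yes refl) _ = inj₁ (inj₁ refl , right-old ≤-refl)
        go (no a≢) j? with S-old a≢ Sa
        ... | inj₂ (inj₁ refl) = contradiction first ¬U₁q
        ... | inj₂ (inj₂ refl) = inj₁ (inj₂ refl , right-old (n≤1+n _))
        ... | inj₁ Sa′ with j?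
        ...   | yes eq = inj₂ (inj₁ eq , Sa′)
        ...   | no j≢ with S-old j≢ Sj
        ...     | inj₁ Sj′         = contradiction (reach-back χ b x Sa′ R , Sj′) (no-violation a j)
        ...     | inj₂ (inj₁ refl) = inj₂ (inj₂ refl , Sa′)
        ...     | inj₂ (inj₂ refl) = contradiction final ¬U₁q

      -- Otherwise the two violations would join up into one already present before
      -- Bob's move, because the vertex he coloured was uncoloured then.
      not-both-sides : ∀ {a j a′ j′} → Violation (U χ₁) (S χ₁) a j → Violation (U χ₁) (S χ₁) a′ j′ →
                       Rightwards a j → ¬ Leftwards a′ j′
      not-both-sides {a} {j} {a′} (reach lt _ first final clean , _) (R′ , _) (a≈ , Sj) (j≈ , Sa′) =
        no-violation a′ j
          (V.join χ (V.extend-reach χ (reach-back χ b x Sa′ R′) Uq j≈) a≈ lt (back first) (back final)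
             (λ k p r → map⊎ back back (clean k p r)) , Sj)

      -- Distinct near ends would be `suc i` and `2 + i`, and the latter would be both uncoloured
      -- and saturated.
      same-right : ∀ {a j a′ j′} → Violation (U χ₁) (S χ₁) a j → Violation (U χ₁) (S χ₁) a′ j′ →
                   Rightwards a j → Rightwards a′ j′ → a′ ≡ a
      same-right _        _         (inj₁ refl , _) (inj₁ refl , _) = refl
      same-right (R , _) (R′ , _) (inj₁ refl , _) (inj₂ refl , _) =
        contradiction (Reach.first R) (S-not-U χ₁ (Reach.sat R′))
      same-right (R , _) (R′ , _) (inj₂ refl , _) (inj₁ refl , _) =
        contradiction (Reach.first R′) (S-not-U χ₁ (Reach.sat R))
      same-right _        _         (inj₂ refl , _) (inj₂ refl , _) = refl

      same-left : ∀ {a j a′ j′} → Violation (U χ₁) (S χ₁) a j → Violation (U χ₁) (S χ₁) a′ j′ →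
                  Leftwards a j → Leftwards a′ j′ → j′ ≡ j
      same-left _         _          (inj₁ refl , _) (inj₁ refl , _) = refl
      same-left (R , _)  (_ , Sj′) (inj₁ refl , _) (inj₂ refl , _) = contradiction (Reach.final R) (S-not-U χ₁ Sj′)
      same-left (_ , Sj) (R′ , _)  (inj₂ refl , _) (inj₁ refl , _) = contradiction (Reach.final R′) (S-not-U χ₁ Sj)
      same-left _         _          (inj₂ refl , _) (inj₂ refl , _) = refl

      violated? : Dec (∃[ j ] (j < suc last × ∃[ a ] (a < j × Violation (U χ₁) (S χ₁) a j)))
      violated? = anyUpTo? (λ j → anyUpTo? (λ a → V.violation? χ₁ (U? χ₁) (S? χ₁) a j) j) (suc last)

      robust-unless-pivot : ¬ (U χ i × U χ (2 + i)) → ∀ l → Robust χ₁ l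
      robust-unless-pivot not-pivot l with l ≟ i
      ... | yes refl = λ d Ul _ Ur → contradiction (back Ul , back Ur) not-pivot
      ... | no ne    = robust₁ l ne

      -- All violations lie on one side and share their near end, so filling the uncoloured vertex
      -- next to that end meets every one of them.
      repair : ¬ (U χ i × U χ (2 + i)) → AllColoured G χ₁ ⊎ Reply χ₁
      repair not-pivot with violated?
      ... | no none = free-move χ₁ record
        { majority     = maj₁
        ; started      = started₁
        ; no-violation = λ a j vi → none (j , s≤s (proj₁ (Reach.final (proj₁ vi))) , a , Reach.lt (proj₁ vi) , vi)
        ; robust       = robust-unless-pivot not-pivot
        ; legs-free    = legs-free₁
        }
      ... | yes (j , _ , a , _ , vi@(R , Sj)) = inj₂ (go (side a j vi) vi)
        where
        go : ∀ {a j} → Rightwards a j ⊎ Leftwards a j → Violation (U χ₁) (S χ₁) a j → Reply χ₁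
        go {a} {j} (inj₁ right) vi@(R , _) = fill χ₁ a maj₁ started₁ legs-free₁ (Reach.first R)
          (inj₁ (S-not-U χ₁ (Reach.sat R))) (λ l _ _ → robust-unless-pivot not-pivot l) inside
          where
          inside : ∀ a′ j′ → Violation (U χ₁) (S χ₁) a′ j′ → a′ < suc a × suc a ≤ j′
          inside a′ j′ vi′ with side a′ j′ vi′
          ... | inj₂ left′  = contradiction left′ (not-both-sides vi vi′ right)
          ... | inj₁ right′ with same-right vi vi′ right right′
          ...   | refl = ≤-refl , Reach.lt (proj₁ vi′)
        go {a} {zero} (inj₂ left) (R , _) = contradiction (Reach.final R) started₁
        go {a} {suc j} (inj₂ left) vi@(R , Sj) = fill χ₁ j maj₁ started₁ legs-free₁ (Reach.final R)
          (inj₂ (proj₁ Sj , S-not-U χ₁ Sj)) (λ l _ _ → robust-unless-pivot not-pivot l) inside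
          where
          inside : ∀ a′ j′ → Violation (U χ₁) (S χ₁) a′ j′ → a′ < suc j × suc j ≤ j′
          inside a′ j′ vi′ with side a′ j′ vi′
          ... | inj₁ right′ = contradiction left (not-both-sides vi′ vi right′)
          ... | inj₂ left′ with same-left vi vi′ left left′
          ...   | refl = Reach.lt (proj₁ vi′) , ≤-refl

      fresh : U χ i → U χ (2 + i) → Fresh χ b x
      fresh (_ , ul) (_ , ur) = spine-fresh χ i x q≤ (λ eq → contradiction (trans (sym eq) ul) λ ())
        (λ _ eq → contradiction (trans (sym eq) ur) λ ())
        (λ u off e eq → contradiction (trans (sym eq) (legs-free (suc i) Uq u off e)) λ ())

      reply : AllColoured G χ₁ ⊎ Reply χ₁
      reply with U? χ i ×-dec U? χ (2 + i)
      ... | no not-pivot = repair not-pivot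
      -- Bob's vertex now lies between two uncoloured ones and may fail robustness; colouring its
      -- right neighbour makes that condition vacuous. There is no violation to cut, since `x` was
      -- absent around the vertex.
      ... | yes (Ul , Ur) = inj₂ (fill χ₁ (suc i) maj₁ started₁ legs-free₁
              (U-keep χ b x (sp≢ (proj₁ Ur) q≤ λ ()) Ur) (inj₁ ¬U₁q) (λ l _ ne → robust₁ l (ne ∘ cong suc))
              λ a j (R , Sj) → contradiction (reach-back χ b x (keep (Reach.sat R)) R , keep Sj) (no-violation a j))
        where
        keep : ∀ {j} → S χ₁ j → S χ j
        keep {j} Sj with j ≟ suc i
        ... | yes refl = contradiction (proj₂ Sj) (fresh-unsaturated χ b x (fresh Ul Ur) (degree≥2-inner (proj₁ Ur)))
        ... | no j≢ with S-update χ b x (sp≢ (proj₁ Sj) q≤ j≢) Sj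
        ...   | inj₁ Sj′      = Sj′
        ...   | inj₂ (e , eq) = contradiction eq (fresh Ul Ur _ (~-sym e))

    module _ (b : Fin n) (x : Fin 3) (off : OffSpine b) (foot : sp (suc i) ~ b)
             (maj₁ : Majority G (χ [ b ]≔ just x)) where

      private
        v = sp (suc i)
        χ₁ = χ [ b ]≔ just x
        back : ∀ {j} → U χ₁ j → U χ j
        back = proj₂ ∘ U-update χ b x
        forward : ∀ {j} → U χ j → U χ₁ j
        forward Uj = U-keep χ b x (off (proj₁ Uj) ∘ sym) Uj
        Uq₁ : U χ₁ (suc i)
        Uq₁ = forward Uq
        started₁ : ¬ U χ₁ 0
        started₁ = started ∘ back
        far : ∀ {j} → j ≤ last → j ≢ suc i → ¬ sp j ~ b
        far j≤ j≢ e = j≢ (foot-unique off j≤ q≤ e foot)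
        S-old : ∀ {j} → S χ₁ j → S χ j
        S-old Sj with S-update χ b x (off (proj₁ Sj) ∘ sym) Sj
        ... | inj₁ Sj′      = Sj′
        ... | inj₂ (e , eq) = ⊥-elim (far (proj₁ Sj) (λ { refl → coloured-not-U χ eq Uq }) e)
        no-viol₁ : ∀ a j → ¬ Violation (U χ₁) (S χ₁) a j
        no-viol₁ a j (R , Sj) = no-violation a j (reach-back χ b x (S-old (Reach.sat R)) R , S-old Sj)
        robust₁ : ∀ l → l ≢ i → Robust χ₁ l
        robust₁ l ne d Ul col Ur = robust-far χ b x l (off (<⇒≤ (proj₁ Ur)) ∘ sym)
          (far (<⇒≤ (proj₁ Ur)) (ne ∘ suc-injective)) (robust l) d Ul col Ur
        legs-free₁ : ∀ j → j ≢ suc i → U χ₁ j → LegsFree χ₁ j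
        legs-free₁ j ne Uj = legs-free-off χ b x (far (proj₁ Uj) ne) (legs-free j (back Uj))
        other-legs : ∀ u → OffSpine u → v ~ u → u ≢ b → Vec.lookup χ₁ u ≡ nothing
        other-legs u offᵤ e ne = trans (lookup∘update′ ne χ (just x)) (legs-free (suc i) Uq u offᵤ e)
        legs-≢ : ∀ {c} → x ≢ c → ∀ u → OffSpine u → v ~ u → Vec.lookup χ₁ u ≢ just c
        legs-≢ x≢c u offᵤ e eq with u ≟ᶠ b
        ... | yes refl = x≢c (just-injective (trans (sym (lookup∘update b χ (just x))) eq))
        ... | no ne    = contradiction (trans (sym eq) (other-legs u offᵤ e ne)) λ ()
        left-edge : v ~ sp i
        left-edge = ~-sym (sp-step q≤)
        deg≥2 : 2 ≤ degree v
        deg≥2 = degree≥2 left-edge foot (off (<⇒≤ q≤) ∘ sym)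
        not-v : ∀ c {j} → U (χ₁ [ v ]≔ just c) j → j ≢ suc i
        not-v c Uj refl = proj₁ (U-update χ₁ v c Uj) refl

      ReplyAtFoot : Set
      ReplyAtFoot = ∃[ c ] (Legal G χ₁ v c × Invariant (χ₁ [ v ]≔ just c))

      -- A colour absent around `v` saturates neither `v` nor any neighbour, so a violation
      -- afterwards would be an old one.
      reply-fresh : ∀ c → x ≢ c → Fresh χ₁ v c → ReplyAtFoot
      reply-fresh c x≢c fresh = c , (proj₂ Uq₁ , maj₂) ,
        invariant-spine χ₁ i c q≤ maj₂ started₁ (λ l _ _ → robust₁ l) pivot legs-free₁ no-viol
        where
        χ₂ = χ₁ [ v ]≔ just c
        maj₂ = fresh-majority χ₁ v c maj₁ fresh
        -- Bob has spent one leg: either none is left, or v has degree at least four.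
        pivot : Robust χ₂ i
        pivot d Ul col Ur u offᵤ e unc
          rewrite just-injective (trans (sym col) (lookup∘update v χ₁ (just c))) =
          ≤-trans (*-monoʳ-≤ 2 (s≤s (s≤s (count-fresh χ₁ v c fresh))))
            (degree≥4 left-edge (sp-step (proj₁ Ur)) foot e
              (sp≢ (proj₁ Ul) (proj₁ Ur) λ ()) (off (proj₁ Ul) ∘ sym) (offᵤ (proj₁ Ul) ∘ sym)
              (off (proj₁ Ur) ∘ sym) (offᵤ (proj₁ Ur) ∘ sym)
              (λ { refl → contradiction (trans (sym (proj₂ (uncoloured-update χ₁ unc)))
                                         (lookup∘update b χ (just x))) λ () }))
        keep : ∀ {j} → S χ₂ j → S χ₁ j
        keep {j} Sj with j ≟ suc i
        ... | yes refl = contradiction (proj₂ Sj) (fresh-unsaturated χ₁ v c fresh deg≥2)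
        ... | no j≢ with S-update χ₁ v c (sp≢ (proj₁ Sj) q≤ j≢) Sj
        ...   | inj₁ Sj′      = Sj′
        ...   | inj₂ (e , eq) = contradiction eq (fresh _ (~-sym e))
        no-viol : ∀ a j → ¬ Violation (U χ₂) (S χ₂) a j
        no-viol a j (R , Sj) = no-viol₁ a j (reach-back χ₁ v c (keep (Reach.sat R)) R , keep Sj)

      -- z is the spine neighbour whose colour is reused; only its saturation may change.
      reply-match : ∀ z c → z ≤ last → Vec.lookup χ₁ (sp z) ≡ just c → ¬ S χ₁ z →
                    (∀ w → v ~ w → Vec.lookup χ₁ w ≡ just c → w ≡ sp z) → ¬ U χ₁ i →
                    (∀ a j → (∀ {k} → k ≢ suc i → k ≢ z → S (χ₁ [ v ]≔ just c) k → S χ₁ k) →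
                             ¬ Violation (U (χ₁ [ v ]≔ just c)) (S (χ₁ [ v ]≔ just c)) a j) →
                    ReplyAtFoot
      reply-match z c z≤ col unsat only ¬Ui no-viol = c , (proj₂ Uq₁ , maj₂) ,
        invariant-spine χ₁ i c q≤ maj₂ started₁ (λ l _ _ → robust₁ l)
          (λ d Ul → contradiction (proj₂ (U-update χ₁ v c Ul)) ¬Ui) legs-free₁ (λ a j → no-viol a j keep)
        where
        maj₂ = matching-majority χ₁ v c (sp z) maj₁ deg≥2 only
          (≮⇒≥ λ full → unsat (z≤ , c , col , full))
        keep : ∀ {k} → k ≢ suc i → k ≢ z → S (χ₁ [ v ]≔ just c) k → S χ₁ k
        keep k≢ k≢z Sk with S-update χ₁ v c (sp≢ (proj₁ Sk) q≤ k≢) Sk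
        ... | inj₁ Sk′      = Sk′
        ... | inj₂ (e , eq) = contradiction (sp-injective (proj₁ Sk) z≤ (only _ (~-sym e) eq)) k≢z

      -- The choice depends on whether a stretch from a saturated vertex on the left reaches `v`. If
      -- so, the right neighbour is unsaturated, or a violation would already exist, and `r` is
      -- reused. If not, the left neighbour is unsaturated, since it would itself start such a
      -- stretch, and `p` is reused.
      reply-forced : ∀ p r → Vec.lookup χ₁ (sp i) ≡ just p → 2 + i ≤ last → Vec.lookup χ₁ (sp (2 + i)) ≡ just r →
                     p ≢ r → x ≢ p → x ≢ r → ReplyAtFoot
      reply-forced p r colₗ r≤ colᵣ p≢r x≢p x≢r
        with anyUpTo? (λ a → V.reach? χ₁ (U? χ₁) (S? χ₁) a (suc i)) (suc i)
      ... | yes (a , _ , R) = reply-match (2 + i) r r≤ colᵣ (λ Sr → no-viol₁ a (suc i) (R , Sr)) only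
              (coloured-not-U χ₁ colₗ) no-viol
        where
        only : ∀ w → v ~ w → Vec.lookup χ₁ w ≡ just r → w ≡ sp (2 + i)
        only w e eq with on-or-off w
        ... | inj₂ offᵥ = contradiction eq (legs-≢ x≢r w offᵥ e)
        ... | inj₁ (j , j≤ , refl) with sp-near q≤ j≤ e
        ...   | inj₁ refl = refl
        ...   | inj₂ refl = contradiction (just-injective (trans (sym colₗ) eq)) p≢r
        no-viol : ∀ a j → (∀ {k} → k ≢ suc i → k ≢ 2 + i → S (χ₁ [ v ]≔ just r) k → S χ₁ k) →
                  ¬ Violation (U (χ₁ [ v ]≔ just r)) (S (χ₁ [ v ]≔ just r)) a j
        no-viol a′ j keep (R′@(reach lt Sa first final clean) , Sj) with a′ ≟ suc i | a′ ≟ 2 + i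
        ... | yes refl | _ = coloured-not-U χ₁ colᵣ (proj₂ (U-update χ₁ v r first))
        ... | no a≢ | no a≢r = no-viol₁ a′ j (reach-back χ₁ v r (keep a≢ a≢r Sa) R′ , keep j≢ j≢r Sj)
          where
          j≢ : suc j ≢ suc i
          j≢ refl = coloured-not-U χ₁ colₗ (proj₂ (U-update χ₁ v r final))
          j≢r : suc j ≢ 2 + i
          j≢r refl = not-v r final refl
        -- A violation starting at `2 + i` would continue the stretch `R` across `v`, uncoloured
        -- until now, to an old violation.
        ... | no _ | yes refl = no-viol₁ a j
              (V.join χ₁ R (inj₂ refl) lt (back₁ first) (back₁ final) (λ k l u → map⊎ back₁ back₁ (clean k l u)) ,
               keep (>⇒≢ (m≤n⇒m≤1+n (<⇒≤ lt))) (>⇒≢ (m≤n⇒m≤1+n lt)) Sj)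
          where
          back₁ : ∀ {k} → U (χ₁ [ v ]≔ just r) k → U χ₁ k
          back₁ = proj₂ ∘ U-update χ₁ v r
      ... | no none = reply-match i p (<⇒≤ q≤) colₗ unsat only (coloured-not-U χ₁ colₗ) no-viol
        where
        unsat : ¬ S χ₁ i
        unsat Si = none (i , ≤-refl , reach ≤-refl Si Uq₁ Uq₁ λ k l u → contradiction (≤-trans u l) (<-irrefl refl))
        only : ∀ w → v ~ w → Vec.lookup χ₁ w ≡ just p → w ≡ sp i
        only w e eq with on-or-off w
        ... | inj₂ offᵥ = contradiction eq (legs-≢ x≢p w offᵥ e)
        ... | inj₁ (j , j≤ , refl) with sp-near q≤ j≤ e
        ...   | inj₁ refl = contradiction (just-injective (trans (sym eq) colᵣ)) p≢r
        ...   | inj₂ refl = refl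
        no-viol : ∀ a j → (∀ {k} → k ≢ suc i → k ≢ i → S (χ₁ [ v ]≔ just p) k → S χ₁ k) →
                  ¬ Violation (U (χ₁ [ v ]≔ just p)) (S (χ₁ [ v ]≔ just p)) a j
        no-viol a j keep (R@(reach lt Sa first final _) , Sj) with suc j ≟ i
        -- A violation ending at `i` would give a stretch that extends over the coloured `i` to `v`.
        ... | yes refl = none (a , m≤n⇒m≤1+n (m≤n⇒m≤1+n lt) , V.extend-reach χ₁ R₁ Uq₁ (inj₂ refl))
          where
          a≢ : a ≢ suc i
          a≢ refl = coloured-not-U χ₁ colᵣ (proj₂ (U-update χ₁ v p first))
          a≢i : a ≢ i
          a≢i refl = not-v p first refl
          R₁ = reach-back χ₁ v p (keep a≢ a≢i Sa) R
        ... | no j≢i = no-viol₁ a j (reach-back χ₁ v p (keep a≢ a≢i Sa) R , keep j≢ j≢i Sj)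
          where
          a≢ : a ≢ suc i
          a≢ refl = coloured-not-U χ₁ colᵣ (proj₂ (U-update χ₁ v p first))
          a≢i : a ≢ i
          a≢i refl = not-v p first refl
          j≢ : suc j ≢ suc i
          j≢ refl = coloured-not-U χ₁ colₗ (proj₂ (U-update χ₁ v p final))

      reply-at-foot : ReplyAtFoot
      reply-at-foot with avoid₃ (Vec.lookup χ₁ (sp i)) (rightColour χ₁ (2 + i)) x
      ... | inj₁ (c , left , right , x≢c) = reply-fresh c x≢c
              (spine-fresh χ₁ i c q≤ left (rightColour-≢ χ₁ (2 + i) right) (legs-≢ x≢c))
      ... | inj₂ (p , r , left , right , p≢r , x≢p , x≢r) =
              let r≤ , colᵣ = rightColour-≡ χ₁ (2 + i) right in
              reply-forced p r left r≤ colᵣ p≢r x≢p x≢r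

      -- At `v`, where a colour is no longer free automatically, Alice's own reply witnesses that
      -- Bob has not blocked the game.
      after-attack : AfterBob χ₁
      after-attack with reply-at-foot
      ... | c , ok , inv₂ = not-blocked χ₁ maj₁ started₁ escape , inj₂ (v , c , ok , inv₂)
        where
        escape : ∀ j → U χ₁ j → LegsFree χ₁ j ⊎ ∃[ c ] Legal G χ₁ (sp j) c
        escape j Uj with j ≟ suc i
        ... | yes refl = inj₂ (c , ok)
        ... | no ne    = inj₁ (legs-free₁ j ne Uj)

  -- Assembling the winning strategy from the replies

  after-bob : ∀ χ → Invariant χ → ∀ b x → Legal G χ b x → AfterBob (χ [ b ]≔ just x)
  after-bob χ inv b x (unc , maj₁) with on-or-off b
  ... | inj₁ (zero , i≤ , refl)  = contradiction (i≤ , unc) (Invariant.started inv)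
  ... | inj₁ (suc i , i≤ , refl) = after-spine χ inv i (i≤ , unc) x maj₁
  ... | inj₂ off with anyUpTo? (λ i → sp i ~? b) (suc last)
  ...   | no none = after-inert χ inv b x unc maj₁ off λ i≤ e → none (_ , s≤s i≤ , e)
  ...   | yes (i , s≤s i≤ , e) with U? χ i
  ...     | no ¬Ui = after-leg χ inv b x unc maj₁ i off i≤ e ¬Ui
  after-bob χ inv b x (unc , maj₁) | inj₂ off | yes (zero , _ , _)  | yes Ui = contradiction Ui (Invariant.started inv)
  after-bob χ inv b x (unc , maj₁) | inj₂ off | yes (suc i , _ , e) | yes Ui = after-attack χ inv i Ui b x off e maj₁

  -- The bound `N` on the uncoloured vertices drops by one per round, although a full round colours
  -- two; this makes the recursion structural.
  bob-loses : ∀ N χ → #uncoloured χ ≤ N → Invariant χ → WinningStrategy G bob χ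
  bob-loses N χ bound inv = bob-move
    (not-blocked χ majority started λ i Ui → inj₁ (legs-free i Ui)) (respond N bound)
    where
    open Invariant inv
    respond : ∀ N → #uncoloured χ ≤ N → ∀ b x → Legal G χ b x → WinningStrategy G alice (χ [ b ]≔ just x)
    respond zero bound b x ok = contradiction (≤-trans (#uncoloured-update χ x (proj₁ ok)) bound) λ ()
    respond (suc N) bound b x ok with after-bob χ inv b x ok
    ... | _ , inj₁ full = finished full
    ... | ¬bl , inj₂ (v , c , ok′ , inv′) = alice-move ¬bl v c ok′
          (bob-loses N _ (≤-trans (<⇒≤ (#uncoloured-update (χ [ b ]≔ just x) c (proj₁ ok′)))
                           (≤-pred (≤-trans (#uncoloured-update χ x (proj₁ ok)) bound))) inv′)

  -- Opening at the end of the spine gives `started`; the other clauses hold because every other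
  -- vertex is still blank.
  alice-wins : AliceWins G 3
  alice-wins = alice-move (λ { (v , unc , stuck) → stuck zero (unc , legal v) }) (sp 0) zero
    (lookup-replicate (sp 0) nothing , legal (sp 0)) (bob-loses _ χ₁ ≤-refl inv)
    where
    χ₀ : Position
    χ₀ = replicate n nothing
    χ₁ = χ₀ [ sp 0 ]≔ just zero
    blank : ∀ {v c} → Vec.lookup χ₀ v ≢ just c
    blank {v} eq = contradiction (trans (sym eq) (lookup-replicate v nothing)) λ ()
    legal : ∀ v → Majority G (χ₀ [ v ]≔ just zero)
    legal v = fresh-majority χ₀ v zero (λ _ _ eq → contradiction eq blank) λ _ _ → blank
    coloured-only : ∀ {j c} → Vec.lookup χ₁ (sp (suc j)) ≡ just c → ¬ suc j ≤ last
    coloured-only eq j≤ = blank (trans (sym (lookup∘update′ (sp≢ j≤ z≤n λ ()) χ₀ (just zero))) eq)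
    inv : Invariant χ₁
    inv = record
      { majority     = legal (sp 0)
      ; started      = λ U₀ → proj₁ (U-update χ₀ (sp 0) zero U₀) refl
      ; no-violation = λ { a j (_ , j≤ , _ , eq , _) → coloured-only eq j≤ }
      ; robust       = λ l d _ col Ur → ⊥-elim (coloured-only col (<⇒≤ (proj₁ Ur)))
      ; legs-free    = λ i Ui u off e → trans (lookup∘update′ (off z≤n) χ₀ (just zero)) (lookup-replicate u nothing)
      }

theorem9 : ∀ {n : ℕ} (C : Graph n) → Is2Caterpillar C →
    ∃[ μ ] (IsMajorityGameChromaticNumber C μ × μ ≤ 3)
theorem9 C cat = least-witness (aliceWins? C) 3 (Strategy.alice-wins C (caterpillar-spine cat))
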